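{- Let $A$ be a set and let $\Gamma$ be any set of unary relations on $A$ (i.e. subsets of $A$) containing some $\gamma\in\Gamma$ with $\emptyset\neq\gamma\subsetneq A$. Then the lattice $(\{\operatorname{Pol}_A Q\mid Q\subseteq \mathrm{DD}(\Gamma)\},\subseteq)$ contains a strictly descending $\omega$-chain of finitely related clones over $\mathrm{DD}(\Gamma)$; that is, there are finite sets $Q_1,Q_2,Q_3,\dots\subseteq \mathrm{DD}(\Gamma)$ such that $\operatorname{Pol}_A Q_{m+1}\subsetneq \operatorname{Pol}_A Q_m$ for all $m\geq 1$.
   Context: An $n$-ary relation on $A$ is a subset of $A^n$; an $n$-ary operation on $A$ is a map $A^n\to A$. Let $\mathrm{O}_A$ be the set of all operations on $A$ of arity $n\geq 1$. An $n$-ary operation $f$ preserves an $m$-ary relation $\rho\subseteq A^m$ (written $f\rhd\rho$) if for all $r_1,\dots,r_n\in\rho$ the $m$-tuple obtained by applying $f$ coordinatewise to $r_1,\dots,r_n$ is in $\rho$. For a set $Q$ of finitary relations on $A$ (of positive arity), $\operatorname{Pol}_A Q=\{f\in \mathrm{O}_A\mid f\rhd\rho \text{ for all }\rho\in Q\}$. A finitely related clone over $\mathrm{DD}(\Gamma)$ is one of the form $\operatorname{Pol}_A Q$ with $Q\subseteq\mathrm{DD}(\Gamma)$ finite. For $n\geq 1$ and $\gamma_1,\dots,\gamma_n\subseteq A$ put $\mathrm{R}(\gamma_1,\dots,\gamma_n)=\{(x_1,\dots,x_n)\in A^n\mid x_1\in\gamma_1\text{ or }\dots\text{ or }x_n\in\gamma_n\}$.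 For a set $\Gamma$ of unary relations on $A$, $\mathrm{DD}(\Gamma)$ is the set of all relations $\mathrm{R}(\gamma_1,\dots,\gamma_n)$ with $n\geq 1$ and $(\gamma_1,\dots,\gamma_n)\in\Gamma^n$. -}

module Defs where

open import Level using (Level; _⊔_; suc)
open import Data.Fin.Base using (Fin)
open import Data.List.Base using (List)
import Data.List.Membership.Propositional as List
open import Data.Nat.Base as ℕ using (ℕ)
open import Data.Product.Base using (Σ-syntax; ∃-syntax; _×_; _,_)
open import Data.Vec.Base using (Vec; lookup; map; transpose)
open import Data.Vec.Relation.Unary.All using (All)
open import Relation.Unary using (Pred; _∈_; _≐_)

private
  variable
    a p q : Level

-- Arities are positive throughout: the stored number n stands for arity 1 + n.

Operation : Set a → Set a
Operation A = Σ[ n ∈ ℕ ] (Vec A (ℕ.suc n) → A)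

Relation : Set a → (p : Level) → Set (a ⊔ suc p)
Relation A p = Σ[ m ∈ ℕ ] Pred (Vec A (ℕ.suc m)) p

-- The tuples r₁, …, rₙ are the rows of rs, so f is applied to its columns.

_▷_ : {A : Set a} → Operation A → Relation A p → Set (a ⊔ p)
_▷_ {A = A} (n , f) (m , ρ) =
  (rs : Vec (Vec A (ℕ.suc m)) (ℕ.suc n)) → All ρ rs → map f (transpose rs) ∈ ρ

Pol : {A : Set a} → Pred (Relation A p) q → Pred (Operation A) (a ⊔ suc p ⊔ q)
Pol Q f = ∀ ρ → ρ ∈ Q → f ▷ ρ

R : {A : Set a} {n : ℕ} → Vec (Pred A p) n → Pred (Vec A n) p
R {n = n} γs xs = ∃[ i ] lookup xs i ∈ lookup γs i

-- Subsets are compared by _≐_, since predicates with the same elements need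
-- not be propositionally equal.

DD : {A : Set a} → Pred (Pred A p) q → Pred (Relation A p) (a ⊔ suc p ⊔ q)
DD {A = A} Γ (n , ρ) = ∃[ γs ] All Γ {n = ℕ.suc n} γs × ρ ≐ R γs

-- Finite sets of relations are given by lists of their elements.

⟦_⟧ : {A : Set a} → List (Relation A p) → Pred (Relation A p) (a ⊔ suc p)
⟦ Q ⟧ ρ = ρ List.∈ Q

{-# OPTIONS --safe #-}
module Submission where

open import Defs
open import Axiom.ExcludedMiddle using (ExcludedMiddle)
open import Data.Bool.Base using (if_then_else_)
open import Data.Fin.Base using (Fin; zero; suc)
import Data.Fin.Base as Fin
import Data.Fin.Properties as Fin
open import Data.List.Base using (List; [_])
open import Data.List.Relation.Unary.Any using (here)
open import Data.Nat.Base using (ℕ; suc)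
open import Data.Nat.Properties using (n<1+n)
open import Data.Product.Base using (∃-syntax; ∃₂; Σ-syntax; _×_; _,_; proj₁; proj₂; map₂)
open import Data.Vec.Base
  using (Vec; []; _∷_; _⊛_; head; lookup; map; replicate; tabulate; transpose)
open import Data.Vec.Properties
  using (lookup-map; lookup-replicate; lookup-⊛; lookup∘tabulate; map-∘; map-cong)
import Data.Vec.Relation.Unary.All.Properties as All
open import Function.Base using (_∘_; id)
open import Level using (Level)
open import Relation.Binary.PropositionalEquality
  using (_≡_; refl; sym; trans; cong; cong₂; subst; module ≡-Reasoning)
open import Relation.Nullary.Decidable using (yes; no; ⌊_⌋)
open import Relation.Nullary.Negation.Core using (¬_; contradiction)
open import Relation.Unary using (Pred; _∈_; _∉_; _⊆_; _⊈_; _⊂_; _≐_; ∅; U)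

-- Let Rₘ = R(γ,…,γ) with m entries. Repeating a coordinate shows
-- Pol Rₘ₊₁ ⊆ Pol Rₘ. To separate them, pick a ∈ γ and b ∉ γ, and let f be the
-- (m+1)-ary operation with value a on tuples having at least two entries in γ,
-- and b otherwise. Any m+1 tuples in Rₘ have, by the pigeonhole principle, two
-- with an entry in γ at the same coordinate, so f preserves Rₘ. The m+1 tuples
-- with a on the diagonal and b elsewhere are in Rₘ₊₁, but f sends them to
-- (b,…,b).

private
  variable
    a p : Level
    A : Set a
    m n : ℕ

column : Fin n → Vec (Vec A n) m → Vec A m
column i = map (λ r → lookup r i)

lookup-transpose : (i : Fin n) (rs : Vec (Vec A n) m) →
                   lookup (transpose rs) i ≡ column i rs
lookup-transpose i [] = lookup-replicate i []
lookup-transpose {n = n} i (r ∷ rs) = begin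
  lookup (transpose (r ∷ rs)) i
    ≡⟨ lookup-⊛ i (replicate n _∷_ ⊛ r) (transpose rs) ⟩
  lookup (replicate n _∷_ ⊛ r) i (lookup (transpose rs) i)
    ≡⟨ cong₂ (λ g → g) (lookup-⊛ i (replicate n _∷_) r) (lookup-transpose i rs) ⟩
  lookup (replicate n _∷_) i (lookup r i) (column i rs)
    ≡⟨ cong (λ g → g (lookup r i) (column i rs)) (lookup-replicate i _∷_) ⟩
  lookup r i ∷ column i rs ∎
  where open ≡-Reasoning

module _ {A : Set a} (γ : Pred A p) where

  Meets : Pred (Vec A n) p
  Meets xs = ∃[ i ] lookup xs i ∈ γ

  power : ℕ → Relation A p
  power m = m , R (replicate (suc m) γ)

  power⇒Meets : (xs : Vec A n) → xs ∈ R (replicate n γ) → xs ∈ Meets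
  power⇒Meets xs (i , x∈) = i , subst (lookup xs i ∈_) (lookup-replicate i γ) x∈

  Meets⇒power : (xs : Vec A n) → xs ∈ Meets → xs ∈ R (replicate n γ)
  Meets⇒power xs (i , x∈) = i , subst (lookup xs i ∈_) (sym (lookup-replicate i γ)) x∈

  -- Coordinatewise form of `(n , f) ▷ power m`, free of `transpose` and `replicate`; all
  -- combinatorial arguments are run on this form.
  Preserves : ∀ m → Pred (Operation A) _
  Preserves m (n , f) = (rs : Vec (Vec A (suc m)) (suc n)) →
    (∀ k → lookup rs k ∈ Meets) → ∃[ i ] f (column i rs) ∈ γ

  lookup-image : (f : Vec A m → A) (rs : Vec (Vec A n) m) (i : Fin n) →
                 lookup (map f (transpose rs)) i ≡ f (column i rs)
  lookup-image f rs i = trans (lookup-map i f (transpose rs)) (cong f (lookup-transpose i rs))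

  ▷⇒Preserves : ∀ f → f ▷ power m → f ∈ Preserves m
  ▷⇒Preserves (_ , f) f▷ rs meets =
    map₂ (λ {i} → subst γ (lookup-image f rs i))
      (power⇒Meets (map f (transpose rs))
        (f▷ rs (All.lookup⁻ λ k → Meets⇒power (lookup rs k) (meets k))))

  Preserves⇒▷ : ∀ f → f ∈ Preserves m → f ▷ power m
  Preserves⇒▷ (_ , f) pres rs rs∈ =
    Meets⇒power (map f (transpose rs)) (map₂ (λ {i} → subst γ (sym (lookup-image f rs i)))
      (pres rs (λ k → power⇒Meets (lookup rs k) (All.lookup⁺ rs∈ k))))

  Preserves-antitone : ∀ f → f ∈ Preserves (suc m) → f ∈ Preserves m
  Preserves-antitone {m = m} (_ , f) pres rs meets with pres (map dup rs) dup-meets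
    where
    dup : Vec A (suc m) → Vec A (suc (suc m))
    dup r = head r ∷ r
    dup-meets : ∀ k → lookup (map dup rs) k ∈ Meets
    dup-meets k rewrite lookup-map k dup rs with i , x∈ ← meets k = suc i , x∈
  -- Index `suc i` of a padded row is index `i` of the original row; index `zero` holds the repeated
  -- head, so it leads back to `zero` as well.
  ... | suc i , y∈ = i , subst (λ c → f c ∈ γ) (sym (map-∘ _ _ rs)) y∈
  ... | zero , y∈ = zero , subst (λ c → f c ∈ γ)
    -- `head` and `lookup` at `zero` agree by computation only once the row is split as a cons.
    (trans (sym (map-∘ _ _ rs)) (map-cong (λ { (_ ∷ _) → refl }) rs)) y∈

  -- Distinctness of the two positions is expressed by `k < l`, the form in which the pigeonhole
  -- principle delivers it.
  MeetsTwice : Pred (Vec A n) p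
  MeetsTwice xs = ∃₂ λ k l → k Fin.< l × lookup xs k ∈ γ × lookup xs l ∈ γ

  module _ (em : ExcludedMiddle p) {a b : A} (a∈γ : a ∈ γ) (b∉γ : b ∉ γ) where

    threshold : Vec A n → A
    threshold xs = if ⌊ em {MeetsTwice xs} ⌋ then a else b

    MeetsTwice⇒threshold∈ : (xs : Vec A n) → xs ∈ MeetsTwice → threshold xs ∈ γ
    MeetsTwice⇒threshold∈ xs twice with em {MeetsTwice xs}
    ... | yes _ = a∈γ
    ... | no ¬twice = contradiction twice ¬twice

    threshold∈⇒MeetsTwice : (xs : Vec A n) → threshold xs ∈ γ → xs ∈ MeetsTwice
    threshold∈⇒MeetsTwice xs t∈γ with em {MeetsTwice xs}
    ... | yes twice = twice
    ... | no _ = contradiction t∈γ b∉γ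

    threshold-Preserves : (suc m , threshold) ∈ Preserves m
    threshold-Preserves {m = m} rs meets
      -- Stored numbers are one below arities: there are m + 2 rows and m + 1 coordinates, and each
      -- row is sent to a coordinate where it meets `γ`.
      with k , l , k<l , iₖ≡iₗ ← Fin.pigeonhole (n<1+n (suc m)) (proj₁ ∘ meets) =
      proj₁ (meets k) ,
      MeetsTwice⇒threshold∈ (column (proj₁ (meets k)) rs)
        (k , l , k<l , entry k refl , entry l (sym iₖ≡iₗ))
      where
      -- Stated for any `i` equal to the coordinate chosen for row `j`, so that it serves rows `k`
      -- and `l` in one common column.
      entry : ∀ j {i} → proj₁ (meets j) ≡ i → lookup (column i rs) j ∈ γ
      entry j refl = subst γ (sym (lookup-map j _ rs)) (proj₂ (meets j))

    diagonal : Fin n → Fin n → A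
    diagonal k i = if ⌊ k Fin.≟ i ⌋ then a else b

    diagonal-∈ : (k : Fin n) → diagonal k k ∈ γ
    diagonal-∈ k with k Fin.≟ k
    ... | yes _ = a∈γ
    ... | no k≢k = contradiction refl k≢k

    diagonal-∈⇒≡ : (k i : Fin n) → diagonal k i ∈ γ → k ≡ i
    diagonal-∈⇒≡ k i d∈γ with k Fin.≟ i
    ... | yes k≡i = k≡i
    ... | no _ = contradiction d∈γ b∉γ

    rows : ∀ n → Vec (Vec A n) n
    rows n = tabulate (λ k → tabulate (diagonal k))

    lookup-rows : (k i : Fin n) → lookup (lookup (rows n) k) i ≡ diagonal k i
    lookup-rows k i = trans (cong (λ r → lookup r i) (lookup∘tabulate _ k)) (lookup∘tabulate _ i)

    rows-Meets : (k : Fin n) → lookup (rows n) k ∈ Meets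
    rows-Meets k = k , subst γ (sym (lookup-rows k k)) (diagonal-∈ k)

    -- Off the diagonal the entries are `b`, which lies outside `γ`; hence no column meets `γ`
    -- twice.
    column-∈⇒≡ : (k i : Fin n) → lookup (column i (rows n)) k ∈ γ → k ≡ i
    column-∈⇒≡ {n = n} k i x∈ =
      diagonal-∈⇒≡ k i (subst γ (trans (lookup-map k _ (rows n)) (lookup-rows k i)) x∈)

    threshold-¬Preserves : (m , threshold) ∉ Preserves m
    threshold-¬Preserves {m = m} pres
      with i , t∈γ ← pres (rows (suc m)) rows-Meets
      with k , l , k<l , k∈ , l∈ ← threshold∈⇒MeetsTwice (column i (rows (suc m))) t∈γ =
      -- Both positions coincide with the column index `i`, against `k < l`.
      Fin.<⇒≢ k<l (trans (column-∈⇒≡ k i k∈) (sym (column-∈⇒≡ l i l∈)))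

  power∈DD : ∀ {q} {Γ : Pred (Pred A p) q} → γ ∈ Γ → power m ∈ DD Γ
  power∈DD {m = m} {Γ = Γ} γ∈Γ =
    replicate (suc m) γ ,
    All.lookup⁻ (λ i → subst Γ (sym (lookup-replicate i γ)) γ∈Γ) ,
    id , id

  Pol-power-⊆ : Pol ⟦ [ power (suc m) ] ⟧ ⊆ Pol ⟦ [ power m ] ⟧
  Pol-power-⊆ {x = f} f∈ _ (here refl) =
    Preserves⇒▷ f (Preserves-antitone f (▷⇒Preserves f (f∈ _ (here refl))))

  Pol-power-⊈ : ExcludedMiddle p → ∀ {a b} → a ∈ γ → b ∉ γ →
                Pol ⟦ [ power m ] ⟧ ⊈ Pol ⟦ [ power (suc m) ] ⟧
  Pol-power-⊈ {m = m} em {a} {b} a∈γ b∉γ sub =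
    threshold-¬Preserves em a∈γ b∉γ (▷⇒Preserves f (sub {f} f∈ _ (here refl)))
    where
    f : Operation A
    -- The arity m + 2 exceeds that of `power m` by one, as the pigeonhole argument needs, and
    -- equals that of `power (suc m)`, which makes the diagonal array square.
    f = suc m , threshold em a∈γ b∉γ
    f∈ : f ∈ Pol ⟦ [ power m ] ⟧
    f∈ _ (here refl) = Preserves⇒▷ f (threshold-Preserves em a∈γ b∉γ)

proposition22 : ∀ {a p q} → ExcludedMiddle p →
    (A : Set a) (Γ : Pred (Pred A p) q) →
    ∃[ γ ] (γ ∈ Γ × ¬ (γ ≐ ∅) × γ ⊂ U) →
    Σ[ Q ∈ (ℕ → List (Relation A p)) ]
    ((∀ m → ⟦ Q m ⟧ ⊆ DD Γ) ×
    (∀ m → Pol ⟦ Q (suc m) ⟧ ⊂ Pol ⟦ Q m ⟧))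
proposition22 em A Γ (γ , γ∈Γ , γ≢∅ , _ , U⊈γ) =
  (λ m → [ power γ m ]) ,
  (λ { m (here refl) → power∈DD γ γ∈Γ }) ,
  λ m → (λ {f} → Pol-power-⊆ γ {x = f}) , λ sub →
    -- Excluded middle is only available at level p, so elements of γ and of its
    -- complement in A cannot be extracted outside the proof of a negation.
    γ≢∅ ((λ a∈γ → U⊈γ (λ {b} _ → inside (λ {f} → sub {f}) a∈γ b)) , λ ())
  where
  -- A point `b` outside `γ` would, together with `a`, yield a threshold operation refuting the
  -- assumed inclusion. The case split is on `γ b`, which lives at level `p`.
  inside : ∀ {m a} → Pol ⟦ [ power γ m ] ⟧ ⊆ Pol ⟦ [ power γ (suc m) ] ⟧ →
           a ∈ γ → ∀ b → b ∈ γ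
  inside sub a∈γ b with em {γ b}
  ... | yes b∈γ = b∈γ
  ... | no b∉γ = contradiction (λ {f} → sub {f}) (Pol-power-⊈ γ em a∈γ b∉γ)
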